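{- Let $\exists X_1 \cdots \exists X_n\, \psi$ be a valid Horn formula equation over a first-order language $\mathcal{L}$ and let $\mu_j = [\mathrm{lfp}_{X_j}\, \Phi_{\psi}]$ for $j \in \{1,\ldots,n\}$. Then: 1. $\models \psi[X_1\backslash \mu_1,\ldots,X_n\backslash\mu_n]$. 2. If $\models \psi[X_1\backslash \chi_1,\ldots,X_n\backslash\chi_n]$ for FO[LFP]-formulas $\chi_1,\ldots,\chi_n$, then $\models \bigwedge_{j=1}^n ( \mu_j \rightarrow \chi_j )$.
   Context: Fix a first-order language $\mathcal{L}$ (with equality). Formulas may contain predicate variables $X,Y,\ldots$, each with an arity. $\mathcal{M},I\models\varphi$ is Tarski satisfaction (second-order quantifiers range over all relations on the domain) and $\models\varphi$ means that $\varphi$ is valid, i.e. true in all $\mathcal{L}$-structures. $\bot$ is always false. If $X$ is $k$-ary and $\chi$ is a formula with free variables $v_1,\ldots,v_k$, then $[X\backslash\chi]$ replaces every atom $X(t_1,\ldots,t_k)$ by $\chi$ with $t_i$ inserted for $v_i$; $[X_1\backslash\chi_1,\ldots,X_n\backslash\chi_n]$ is the simultaneous substitution (similarly with predicates or relations in place of the $\chi_i$). An implication such as $\mu_j\to\chi_j$ between predicates or formulas of the same arity means $\forall \overline{x}\,(\mu_j(\overline{x})\to\chi_j(\overline{x}))$. Horn formula equations: a constrained Horn clause is a formula $\varphi \land X_{i_1}(\overline{t_1}) \land \cdots \land X_{i_m}(\overline{t_m}) \to X_{i_0}(\overline{s})$ or $\varphi \land X_{i_1}(\overline{t_1}) \land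 \cdots \land X_{i_m}(\overline{t_m}) \to \bot$, $m\ge 0$, where $\varphi$ is a first-order $\mathcal{L}$-formula without predicate variables and $\overline{t_1},\ldots,\overline{t_m},\overline{s}$ are tuples of $\mathcal{L}$-terms of appropriate arity. Clauses may contain free individual variables. A Horn formula equation is a formula $\exists X_1\cdots\exists X_n\,\psi$ where $\psi$ is $\forall^*\bigwedge_{C\in S}C$ for a finite set $S$ of constrained Horn clauses in the predicate variables $X_1,\ldots,X_n$, $\forall^*$ being universal closure over individual variables. It is valid if it is a valid second-order formula. FO[LFP]: first-order logic extended by simultaneous least fixed points. For a tuple $\Phi=(\varphi_i(X_1,\ldots,X_n,\overline{u_i}))_{i=1}^n$ of formulas in which the $X_j$ occur only positively, with $|\overline{u_i}|=k_i$ the arity of $X_i$, and a structure $\mathcal{M}$ with domain $M$, the operator $F_\Phi=(F_1,\ldots,F_n)$ on $\mathcal{P}(M^{k_1})\times\cdots\times\mathcal{P}(M^{k_n})$ is defined by $F_i(R_1,\ldots,R_n)=\{\overline{a}\in M^{k_i}\mid \mathcal{M}\models\varphi_i(R_1,\ldots,R_n,\overline{a})\}$. It is monotone; the predicate $[\mathrm{lfp}_{X_i}\,\Phi]$ is interpreted in $\mathcal{M}$ as the $i$-th component of the least fixed point of $F_\Phi$. The tuple $\Phi_\psi$: let $B_j$ be the set of clauses of $\psi$ of the form $\varphi\to X_j(\overline{s})$, written $(\varphi,\overline{s})$, and $I_j$ the set of clauses of the form $\varphi\land X_{i_1}(\overline{t_1})\land\cdots\land X_{i_m}(\overline{t_m})\to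 X_j(\overline{s})$ with $m\ge1$, written $(\varphi,\iota,\tau,\overline{s})$ with $\iota=(i_1,\ldots,i_m)$, $\tau=(\overline{t_1},\ldots,\overline{t_m})$. Then $\Phi_\psi=(\varphi_j(X_1,\ldots,X_n,\overline{x_j}))_{j=1}^n$, where $\varphi_j$ is $$\exists \overline{y}\left(\bigvee_{(\varphi,\overline{s})\in B_j}(\varphi\land\overline{x_j}=\overline{s})\lor\bigvee_{(\varphi,\iota,\tau,\overline{s})\in I_j}\Big(\varphi\land\bigwedge_{k=1}^m X_{i_k}(\overline{t_k})\land\overline{x_j}=\overline{s}\Big)\right),$$ $\overline{y}$ being the free variables of the clauses in $B_j\cup I_j$ and $\overline{x_j}$ a tuple of fresh variables whose length is the arity of $X_j$ (empty disjunctions are false). -}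

module Defs where

open import Level using (Level; Lift; _⊔_) renaming (suc to lsuc)
open import Data.Bool.Base using (Bool; T)
open import Data.Empty using (⊥)
import Data.Empty.Polymorphic as Poly
open import Data.Fin.Base using (Fin; _↑ˡ_; _↑ʳ_)
open import Data.Fin.Properties using (_≟_)
open import Data.List.Base as List using (List; []; _∷_)
open import Data.Maybe.Base using (Maybe; just; nothing)
open import Data.Nat.Base using (ℕ; zero; suc; _+_)
open import Data.Product.Base using (Σ-syntax; ∃-syntax; _×_; _,_)
open import Data.Sign.Base using (Sign; opposite) renaming (+ to ⊕; - to ⊖)
open import Data.Sum.Base using (_⊎_; inj₁; inj₂; [_,_])
open import Data.Unit.Base using (⊤; tt)
open import Data.Vec.Base as Vec using (Vec; []; _∷_; _++_)
open import Function.Bundles using (_⇔_)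
open import Relation.Binary.PropositionalEquality using (_≡_; _≢_; refl)
open import Relation.Nullary using (yes; no)

private variable
  a ℓ : Level

record Language (a : Level) : Set (lsuc a) where
  field
    Fun   : Set a
    Pred  : Set a
    arity : Fun → ℕ
    rank  : Pred → ℕ

open Language

-- A context of predicate variables is a function from the variables to their
-- arities.  Predicate variables are bound in finite blocks X₁,…,Xₘ.

∅ : ⊥ → ℕ
∅ ()

infixl 5 _▹_
_▹_ : {V : Set} → (V → ℕ) → {m : ℕ} → (Fin m → ℕ) → (Fin m ⊎ V → ℕ)
ar ▹ ks = [ ks , ar ]

-- FO       : no second-order quantifiers and no fixed points
-- SO       : FO with second-order quantifiers
-- FO[LFP]  : FO with simultaneous least fixed points

data Logic : Set where
  FO SO FO[LFP] : Logic

private variable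
  l    : Logic
  k m n p : ℕ
  V    : Set
  ar   : V → ℕ

module _ (𝓛 : Language a) where

  -- Individual variables are de Bruijn indices: n is the number in scope.

  data Term (n : ℕ) : Set a where
    var : Fin n → Term n
    fun : (f : Fun 𝓛) → Vec (Term n) (arity 𝓛 f) → Term n

  infixr 7 _∧̇_
  infixr 6 _∨̇_
  infixr 5 _⇒̇_
  infix  8 _≐_

  data Formula {V : Set} (ar : V → ℕ) (n : ℕ) : Logic → Set a

  -- Only s X φ : every free occurrence of X in φ has sign s.
  Only : {V : Set} {ar : V → ℕ} {n : ℕ} {l : Logic} →
         Sign → V → Formula ar n l → Set

  data Formula {V} ar n where
    ⊥̇    : Formula ar n l
    _≐_  : Term n → Term n → Formula ar n l
    rel  : (P : Pred 𝓛) → Vec (Term n) (rank 𝓛 P) → Formula ar n l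
    pvar : (X : V) → Vec (Term n) (ar X) → Formula ar n l
    _∧̇_  : Formula ar n l → Formula ar n l → Formula ar n l
    _∨̇_  : Formula ar n l → Formula ar n l → Formula ar n l
    _⇒̇_  : Formula ar n l → Formula ar n l → Formula ar n l
    ∀̇    : Formula ar (suc n) l → Formula ar n l
    ∃̇    : Formula ar (suc n) l → Formula ar n l
    -- ∀X₁⋯∀Xₘ φ and ∃X₁⋯∃Xₘ φ
    ∀²   : {m : ℕ} (ks : Fin m → ℕ) → Formula (ar ▹ ks) n SO → Formula ar n SO
    ∃²   : {m : ℕ} (ks : Fin m → ℕ) → Formula (ar ▹ ks) n SO → Formula ar n SO
    -- [lfp_{X_i} (φ_j(X₁,…,Xₘ,ū_j))_j](t̄).  Inside φ_j the first ks j
    -- individual variables are ū_j; the φ_j may have further individual and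
    -- predicate variables free as parameters.
    lfp  : {m : ℕ} (ks : Fin m → ℕ)
           (Φ : ∀ j → Formula (ar ▹ ks) (ks j + n) FO[LFP]) →
           (∀ j X → Only ⊕ (inj₁ X) (Φ j)) →
           (i : Fin m) → Vec (Term n) (ks i) → Formula ar n FO[LFP]

  Only s X ⊥̇             = ⊤
  Only s X (t ≐ u)       = ⊤
  Only s X (rel P ts)    = ⊤
  Only ⊕ X (pvar Y ts)   = ⊤
  Only ⊖ X (pvar Y ts)   = Y ≢ X
  Only s X (φ ∧̇ ψ)       = Only s X φ × Only s X ψ
  Only s X (φ ∨̇ ψ)       = Only s X φ × Only s X ψ
  Only s X (φ ⇒̇ ψ)       = Only (opposite s) X φ × Only s X ψ
  Only s X (∀̇ φ)         = Only s X φ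
  Only s X (∃̇ φ)         = Only s X φ
  Only s X (∀² ks φ)     = Only s (inj₂ X) φ
  Only s X (∃² ks φ)     = Only s (inj₂ X) φ
  Only s X (lfp ks Φ _ i ts) = ∀ j → Only s (inj₂ X) (Φ j)

module _ {𝓛 : Language a} where

  ⊤̇ : Formula 𝓛 ar n l
  ⊤̇ = ⊥̇ ⇒̇ ⊥̇

  ⋀ : List (Formula 𝓛 ar n l) → Formula 𝓛 ar n l
  ⋀ = List.foldr _∧̇_ ⊤̇

  ⋁ : List (Formula 𝓛 ar n l) → Formula 𝓛 ar n l
  ⋁ = List.foldr _∨̇_ ⊥̇

  ∀* : ∀ v → Formula 𝓛 ar v l → Formula 𝓛 ar 0 l
  ∀* zero    φ = φ
  ∀* (suc v) φ = ∀* v (∀̇ φ)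

  ∃* : ∀ v → Formula 𝓛 ar (v + n) l → Formula 𝓛 ar n l
  ∃* zero    φ = φ
  ∃* (suc v) φ = ∃* v (∃̇ φ)

  infix 8 _≐*_
  _≐*_ : Vec (Term 𝓛 n) k → Vec (Term 𝓛 n) k → Formula 𝓛 ar n l
  ts ≐* us = ⋀ (Vec.toList (Vec.zipWith _≐_ ts us))

  substTerm  : Vec (Term 𝓛 p) n → Term 𝓛 n → Term 𝓛 p
  substTerms : Vec (Term 𝓛 p) n → Vec (Term 𝓛 n) k → Vec (Term 𝓛 p) k

  substTerm σ (var x)    = Vec.lookup σ x
  substTerm σ (fun f ts) = fun f (substTerms σ ts)

  substTerms σ []       = []
  substTerms σ (t ∷ ts) = substTerm σ t ∷ substTerms σ ts

  varsˡ : ∀ k n → Vec (Term 𝓛 (k + n)) k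
  varsˡ k n = Vec.tabulate λ x → var (x ↑ˡ n)

  varsʳ : ∀ k n → Vec (Term 𝓛 (k + n)) n
  varsʳ k n = Vec.tabulate λ x → var (k ↑ʳ x)

  vars : ∀ n → Vec (Term 𝓛 n) n
  vars n = Vec.tabulate var

  lift : ∀ k → Vec (Term 𝓛 p) n → Vec (Term 𝓛 (k + p)) (k + n)
  lift {p = p} k σ = varsˡ k p ++ substTerms (varsʳ k p) σ

  subst      : Vec (Term 𝓛 p) n → Formula 𝓛 ar n l → Formula 𝓛 ar p l
  subst-Only : ∀ {s X} (σ : Vec (Term 𝓛 p) n) (φ : Formula 𝓛 ar n l) →
               Only 𝓛 s X φ → Only 𝓛 s X (subst σ φ)

  subst σ ⊥̇           = ⊥̇
  subst σ (t ≐ u)     = substTerm σ t ≐ substTerm σ u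
  subst σ (rel P ts)  = rel P (substTerms σ ts)
  subst σ (pvar X ts) = pvar X (substTerms σ ts)
  subst σ (φ ∧̇ ψ)     = subst σ φ ∧̇ subst σ ψ
  subst σ (φ ∨̇ ψ)     = subst σ φ ∨̇ subst σ ψ
  subst σ (φ ⇒̇ ψ)     = subst σ φ ⇒̇ subst σ ψ
  subst σ (∀̇ φ)       = ∀̇ (subst (lift 1 σ) φ)
  subst σ (∃̇ φ)       = ∃̇ (subst (lift 1 σ) φ)
  subst σ (∀² ks φ)   = ∀² ks (subst σ φ)
  subst σ (∃² ks φ)   = ∃² ks (subst σ φ)
  subst σ (lfp ks Φ pos i ts) =
    lfp ks (λ j → subst (lift (ks j) σ) (Φ j))
        (λ j X → subst-Only (lift (ks j) σ) (Φ j) (pos j X))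
        i (substTerms σ ts)

  subst-Only σ ⊥̇ o = tt
  subst-Only σ (t ≐ u) o = tt
  subst-Only σ (rel P ts) o = tt
  subst-Only {s = ⊕} σ (pvar X ts) o = tt
  subst-Only {s = ⊖} σ (pvar X ts) o = o
  subst-Only σ (φ ∧̇ ψ) (o , o′) = subst-Only σ φ o , subst-Only σ ψ o′
  subst-Only σ (φ ∨̇ ψ) (o , o′) = subst-Only σ φ o , subst-Only σ ψ o′
  subst-Only σ (φ ⇒̇ ψ) (o , o′) = subst-Only σ φ o , subst-Only σ ψ o′
  subst-Only σ (∀̇ φ) o = subst-Only (lift 1 σ) φ o
  subst-Only σ (∃̇ φ) o = subst-Only (lift 1 σ) φ o
  subst-Only σ (∀² ks φ) o = subst-Only σ φ o
  subst-Only σ (∃² ks φ) o = subst-Only σ φ o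
  subst-Only σ (lfp ks Φ pos i ts) o j = subst-Only (lift (ks j) σ) (Φ j) (o j)

  -- φ [ χ ]: simultaneous substitution of the formula χ X, whose free
  -- individual variables are the ar X arguments, for each predicate variable X.

  infix 9 _[_]
  _[_] : {V W : Set} {ar : V → ℕ} {ar′ : W → ℕ} → Formula 𝓛 ar n FO →
         (∀ X → Formula 𝓛 ar′ (ar X) l) → Formula 𝓛 ar′ n l
  ⊥̇         [ χ ] = ⊥̇
  (t ≐ u)   [ χ ] = t ≐ u
  rel P ts  [ χ ] = rel P ts
  pvar X ts [ χ ] = subst ts (χ X)
  (φ ∧̇ ψ)   [ χ ] = φ [ χ ] ∧̇ ψ [ χ ]
  (φ ∨̇ ψ)   [ χ ] = φ [ χ ] ∨̇ ψ [ χ ]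
  (φ ⇒̇ ψ)   [ χ ] = φ [ χ ] ⇒̇ ψ [ χ ]
  ∀̇ φ       [ χ ] = ∀̇ (φ [ χ ])
  ∃̇ φ       [ χ ] = ∃̇ (φ [ χ ])

  -- A formula without predicate variables, regarded as a formula of any logic
  -- over any context of predicate variables.
  embed : Formula 𝓛 ∅ n FO → Formula 𝓛 ar n l
  embed φ = φ [ (λ ()) ]

-- Semantics.  The metatheory of the mathematics is classical, so the powerset
-- of A is A → Bool.  This keeps the second-order quantifiers and the fixed
-- points within the universe of the domain; under excluded middle every
-- predicate in that universe is represented by such a function.

𝒫 : Set ℓ → Set ℓ
𝒫 A = A → Bool

infix 4 _∈_
_∈_ : {A : Set ℓ} → A → 𝒫 A → Set ℓ
_∈_ {ℓ} x R = Lift ℓ (T (R x))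

record Structure (𝓛 : Language a) (ℓ : Level) : Set (a ⊔ lsuc ℓ) where
  field
    Domain    : Set ℓ
    inhabited : Domain
    funI      : (f : Fun 𝓛) → Vec Domain (arity 𝓛 f) → Domain
    predI     : (P : Pred 𝓛) → 𝒫 (Vec Domain (rank 𝓛 P))

open Structure

-- For V = Fin m this is 𝒫(M^k₁) × ⋯ × 𝒫(M^kₘ).
Relations : {V : Set} → Set ℓ → (V → ℕ) → Set ℓ
Relations M ar = ∀ X → 𝒫 (Vec M (ar X))

-- The values of an operator on Relations M ks are given as predicates, and
-- equality and inclusion of tuples of relations are extensional.
module _ {M : Set ℓ} {m : ℕ} {ks : Fin m → ℕ}
         (F : Relations M ks → ∀ i → Vec M (ks i) → Set ℓ) where

  IsFixedPoint : Relations M ks → Set ℓ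
  IsFixedPoint R = ∀ i xs → F R i xs ⇔ xs ∈ R i

  IsLeastFixedPoint : Relations M ks → Set ℓ
  IsLeastFixedPoint R =
    IsFixedPoint R × (∀ S → IsFixedPoint S → ∀ i xs → xs ∈ R i → xs ∈ S i)

module _ {𝓛 : Language a} (M : Structure 𝓛 ℓ) where

  eval  : Vec (Domain M) n → Term 𝓛 n → Domain M
  evals : Vec (Domain M) n → Vec (Term 𝓛 n) k → Vec (Domain M) k

  eval ρ (var x)    = Vec.lookup ρ x
  eval ρ (fun f ts) = funI M f (evals ρ ts)

  evals ρ []       = []
  evals ρ (t ∷ ts) = eval ρ t ∷ evals ρ ts

  -- Sat I ρ φ : M , I ⊨ φ, where ρ assigns values to the individual variables
  -- and I to the predicate variables.
  Sat : Relations (Domain M) ar → Vec (Domain M) n → Formula 𝓛 ar n l → Set ℓ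
  Sat I ρ ⊥̇           = Poly.⊥
  Sat I ρ (t ≐ u)     = eval ρ t ≡ eval ρ u
  Sat I ρ (rel P ts)  = evals ρ ts ∈ predI M P
  Sat I ρ (pvar X ts) = evals ρ ts ∈ I X
  Sat I ρ (φ ∧̇ ψ)     = Sat I ρ φ × Sat I ρ ψ
  Sat I ρ (φ ∨̇ ψ)     = Sat I ρ φ ⊎ Sat I ρ ψ
  Sat I ρ (φ ⇒̇ ψ)     = Sat I ρ φ → Sat I ρ ψ
  Sat I ρ (∀̇ φ)       = ∀ x → Sat I (x ∷ ρ) φ
  Sat I ρ (∃̇ φ)       = ∃[ x ] Sat I (x ∷ ρ) φ
  Sat I ρ (∀² ks φ)   = (R : Relations (Domain M) ks) → Sat [ R , I ] ρ φ
  Sat I ρ (∃² ks φ)   = Σ[ R ∈ Relations (Domain M) ks ] Sat [ R , I ] ρ φ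
  Sat I ρ (lfp ks Φ _ i ts) =
    Σ[ R ∈ Relations (Domain M) ks ]
      IsLeastFixedPoint (λ S j xs → Sat [ S , I ] (xs ++ ρ) (Φ j)) R
      × evals ρ ts ∈ R i

-- Validity of a sentence; ℓ is the universe of the structures considered.
Valid : {𝓛 : Language a} (ℓ : Level) → Formula 𝓛 ∅ 0 l → Set (a ⊔ lsuc ℓ)
Valid {𝓛 = 𝓛} ℓ φ = (M : Structure 𝓛 ℓ) → Sat M (λ ()) [] φ

module _ (𝓛 : Language a) {n : ℕ} (ks : Fin n → ℕ) where

  Atom : ℕ → Set a
  Atom v = Σ[ i ∈ Fin n ] Vec (Term 𝓛 v) (ks i)

  -- constraint ∧ body → head, where the head ⊥ is `nothing`.
  record Clause (v : ℕ) : Set a where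
    constructor clause
    field
      constraint : Formula 𝓛 ∅ v FO
      body       : List (Atom v)
      head       : Maybe (Atom v)

  -- A finite set of constrained Horn clauses in X₁,…,Xₙ; v is the number of
  -- individual variables that may occur free in the clauses.
  record HornClauses : Set a where
    constructor hornClauses
    field
      {v}     : ℕ
      clauses : List (Clause v)

  -- A formula (φ , ī , t̄s , s̄) of B_j or I_j with head X_j(s̄).
  record BaseClause (v : ℕ) (j : Fin n) : Set a where
    constructor base
    field
      constraint : Formula 𝓛 ∅ v FO
      args       : Vec (Term 𝓛 v) (ks j)

  record InductionClause (v : ℕ) (j : Fin n) : Set a where
    constructor induction
    field
      constraint : Formula 𝓛 ∅ v FO
      body₁      : Atom v
      bodyₘ      : List (Atom v)
      args       : Vec (Term 𝓛 v) (ks j)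

module _ {𝓛 : Language a} {n : ℕ} {ks : Fin n → ℕ} where

  atom : Atom 𝓛 ks k → Formula 𝓛 (∅ ▹ ks) k l
  atom (i , ts) = pvar (inj₁ i) ts

  headFormula : Maybe (Atom 𝓛 ks k) → Formula 𝓛 (∅ ▹ ks) k l
  headFormula nothing  = ⊥̇
  headFormula (just A) = atom A

  clauseFormula : Clause 𝓛 ks k → Formula 𝓛 (∅ ▹ ks) k l
  clauseFormula (clause φ body head) =
    List.foldl _∧̇_ (embed φ) (List.map atom body) ⇒̇ headFormula head

  -- ψ = ∀* ⋀_{C ∈ S} C
  ⟦_⟧ : HornClauses 𝓛 ks → Formula 𝓛 (∅ ▹ ks) 0 l
  ⟦ hornClauses {v} S ⟧ = ∀* v (⋀ (List.map clauseFormula S))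

  hornEquation : HornClauses 𝓛 ks → Formula 𝓛 ∅ 0 SO
  hornEquation ψ = ∃² ks ⟦ ψ ⟧

  -- ψ[X₁\χ₁,…,Xₙ\χₙ], where χ_j has exactly the arguments v₁,…,v_{k_j} free
  _⟨_⟩ : HornClauses 𝓛 ks → (∀ j → Formula 𝓛 ∅ (ks j) l) → Formula 𝓛 ∅ 0 l
  ψ ⟨ χ ⟩ = ⟦ ψ ⟧ [ [ χ , (λ ()) ] ]

  asBase : (j : Fin n) → Clause 𝓛 ks k → Maybe (BaseClause 𝓛 ks k j)
  asBase j (clause φ [] (just (i , s))) with i ≟ j
  ... | yes refl = just (base φ s)
  ... | no _     = nothing
  asBase j _ = nothing

  asInduction : (j : Fin n) → Clause 𝓛 ks k → Maybe (InductionClause 𝓛 ks k j)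
  asInduction j (clause φ (A ∷ As) (just (i , s))) with i ≟ j
  ... | yes refl = just (induction φ A As s)
  ... | no _     = nothing
  asInduction j _ = nothing

  -- The disjuncts of φ_j, in the context ȳ , x̄_j.

  module _ {v : ℕ} {j : Fin n} where

    private
      K = ks j
      ȳ : Vec (Term 𝓛 (v + K)) v
      ȳ = varsˡ v K
      x̄ : Vec (Term 𝓛 (v + K)) K
      x̄ = varsʳ v K

    baseDisjunct : BaseClause 𝓛 ks v j → Formula 𝓛 (∅ ▹ ks) (v + K) l
    baseDisjunct (base φ s) =
      embed (subst ȳ φ) ∧̇ x̄ ≐* substTerms ȳ s

    inductionDisjunct : InductionClause 𝓛 ks v j → Formula 𝓛 (∅ ▹ ks) (v + K) l
    inductionDisjunct (induction φ A As s) =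
      embed (subst ȳ φ)
      ∧̇ ⋀ (List.map (λ B → subst ȳ (atom B)) (A ∷ As))
      ∧̇ x̄ ≐* substTerms ȳ s

  -- ȳ consists of all variables in the scope of ψ; since domains are inhabited,
  -- quantifying over those not occurring in B_j ∪ I_j has no effect.
  Φ[_] : HornClauses 𝓛 ks → ∀ j → Formula 𝓛 (∅ ▹ ks) (ks j) l
  Φ[ hornClauses {v} S ] j =
    ∃* v (⋁ (List.map baseDisjunct (List.mapMaybe (asBase j) S))
          ∨̇ ⋁ (List.map inductionDisjunct (List.mapMaybe (asInduction j) S)))

  module _ {V : Set} {ar : V → ℕ} {X : V} where

    ∃*-Only : ∀ v (φ : Formula 𝓛 ar (v + k) l) →
              Only 𝓛 ⊕ X φ → Only 𝓛 ⊕ X (∃* v φ)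
    ∃*-Only zero    φ o = o
    ∃*-Only (suc v) φ o = ∃*-Only v (∃̇ φ) o

    ⋁-Only : {A : Set a} (f : A → Formula 𝓛 ar k l) → (∀ x → Only 𝓛 ⊕ X (f x)) →
             ∀ xs → Only 𝓛 ⊕ X (⋁ (List.map f xs))
    ⋁-Only f o []       = tt
    ⋁-Only f o (x ∷ xs) = o x , ⋁-Only f o xs

    ⋀-Only : {A : Set a} (f : A → Formula 𝓛 ar k l) → (∀ x → Only 𝓛 ⊕ X (f x)) →
             ∀ xs → Only 𝓛 ⊕ X (⋀ (List.map f xs))
    ⋀-Only f o []       = tt , tt
    ⋀-Only f o (x ∷ xs) = o x , ⋀-Only f o xs

    ≐*-Only : (ts us : Vec (Term 𝓛 k) p) →
              Only 𝓛 ⊕ X (_≐*_ {ar = ar} {l = l} ts us)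
    ≐*-Only []       []       = tt , tt
    ≐*-Only (t ∷ ts) (u ∷ us) = tt , ≐*-Only ts us

    embed-Only : ∀ s (φ : Formula 𝓛 ∅ k FO) →
                 Only 𝓛 s X (embed {ar = ar} {l = l} φ)
    embed-Only s ⊥̇          = tt
    embed-Only s (t ≐ u)    = tt
    embed-Only s (rel P ts) = tt
    embed-Only s (φ ∧̇ ψ)    = embed-Only s φ , embed-Only s ψ
    embed-Only s (φ ∨̇ ψ)    = embed-Only s φ , embed-Only s ψ
    embed-Only s (φ ⇒̇ ψ)    = embed-Only (opposite s) φ , embed-Only s ψ
    embed-Only s (∀̇ φ)      = embed-Only s φ
    embed-Only s (∃̇ φ)      = embed-Only s φ

  Φ-Only : (ψ : HornClauses 𝓛 ks) → ∀ j X → Only 𝓛 ⊕ X (Φ[_] {l = l} ψ j)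
  Φ-Only {l = l} (hornClauses {v} S) j X = ∃*-Only v _
    ( ⋁-Only baseDisjunct base-Only (List.mapMaybe (asBase j) S)
    , ⋁-Only inductionDisjunct induction-Only (List.mapMaybe (asInduction j) S))
    where
    ȳ = varsˡ v (ks j)
    x̄ = varsʳ v (ks j)

    base-Only : ∀ C → Only 𝓛 ⊕ X (baseDisjunct {l = l} C)
    base-Only (base φ s) =
      embed-Only ⊕ (subst ȳ φ) , ≐*-Only x̄ (substTerms ȳ s)

    induction-Only : ∀ C → Only 𝓛 ⊕ X (inductionDisjunct {l = l} C)
    induction-Only (induction φ A As s) =
      embed-Only ⊕ (subst ȳ φ)
      , ⋀-Only (λ B → subst ȳ (atom B)) (λ _ → tt) (A ∷ As)
      , ≐*-Only x̄ (substTerms ȳ s)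

  -- The predicate [lfp_{X_j} Φ_ψ] as a formula in its arguments v₁,…,v_{k_j}.
  -- The body of the fixed point is weakened, as it may not mention them.
  μ : HornClauses 𝓛 ks → ∀ j → Formula 𝓛 ∅ (ks j) FO[LFP]
  μ ψ j = lfp ks (λ i → subst (varsˡ (ks i) (ks j)) (Φ[ ψ ] i))
                 (λ i X → subst-Only _ (Φ[ ψ ] i) (Φ-Only ψ i (inj₁ X)))
                 j (vars (ks j))

{-# OPTIONS --safe #-}

-- On Relations, the operator of Φ_ψ sends S to the set of heads X_j(s̄) of the
-- instances of clauses of ψ whose antecedent holds in S.  So S satisfies the
-- clauses of ψ whose head is not ⊥ exactly if S is a prefixed point, and by
-- Knaster–Tarski the interpretation of μ is the least such S.  In particular μ
-- lies below every solution, which is part 2; for part 1 a clause with head ⊥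
-- cannot fail in μ, since its antecedent would then hold in the solution given
-- by the validity of the Horn formula equation.

module Submission where

open import Defs
open import Axiom.ExcludedMiddle using (ExcludedMiddle)
open import Data.Fin.Base using (Fin)
open import Data.List.Base as List using (List; []; _∷_; tabulate)
open import Data.Nat.Base using (ℕ; zero; suc; _+_)
open import Data.Product.Base as Product
  using (Σ-syntax; ∃; ∃-syntax; _×_; _,_; proj₁; proj₂)
import Data.Empty.Polymorphic as Poly
open import Data.Fin.Properties using (_≟_)
open import Data.List.Membership.Propositional using (lose) renaming (_∈_ to _∈ˡ_)
open import Data.List.Relation.Unary.All as All using (All; []; _∷_)
import Data.List.Relation.Unary.All.Properties as All
open import Data.List.Relation.Unary.Any as Any using (Any; here; there)
import Data.List.Relation.Unary.Any.Properties as Any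
open import Data.Maybe.Base using (Maybe; just; nothing)
open import Data.Maybe.Relation.Unary.Any as MAny using (just)
open import Data.Product.Function.Dependent.Propositional using (Σ-⇔)
open import Data.Product.Function.NonDependent.Propositional using (_×-⇔_)
open import Data.Sum.Base using (_⊎_; inj₁; inj₂; [_,_])
open import Data.Sum.Function.Propositional using (_⊎-⇔_)
open import Data.Vec.Base as Vec using (Vec; []; _∷_; _++_)
open import Data.Vec.Properties
  using (lookup-++ˡ; lookup-++ʳ; tabulate∘lookup; tabulate-cong; ∷-injective)
open import Function.Base using (_∘_)
open import Function.Bundles using (_⇔_; mk⇔; Equivalence)
open import Function.Construct.Identity using (⇔-id; ↠-id)
open import Function.Construct.Symmetry using (⇔-sym)
open import Function.Properties.Equivalence using () renaming (trans to ⇔-trans)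
open import Function.Related.TypeIsomorphisms using (→-cong-⇔)
open import Level using (Level; _⊔_; lower)
open import Relation.Binary.PropositionalEquality as ≡
  using (_≡_; refl; sym; trans; cong; cong₂)
open import Relation.Nullary using (yes; no; contradiction)
open import Relation.Nullary.Decidable using (⌊_⌋; toWitness; fromWitness)

open Equivalence using (to; from)

private variable
  a b c ℓ : Level
  l       : Logic
  k m n p : ℕ
  A B     : Set a
  V W     : Set
  ar      : V → ℕ
  ar′     : W → ℕ

-- Equivalences under quantifiers and list operations.

∀-⇔ : {P : A → Set b} {Q : A → Set c} →
      (∀ x → P x ⇔ Q x) → (∀ x → P x) ⇔ (∀ x → Q x)
∀-⇔ P⇔Q = mk⇔ (λ f x → to (P⇔Q x) (f x)) (λ f x → from (P⇔Q x) (f x))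

∃-⇔ : {P : A → Set b} {Q : A → Set c} →
      (∀ x → P x ⇔ Q x) → ∃ P ⇔ ∃ Q
∃-⇔ P⇔Q = Σ-⇔ (↠-id _) (P⇔Q _)

≡⇒⇔ : (P : A → Set b) {x y : A} → x ≡ y → P x ⇔ P y
≡⇒⇔ P refl = ⇔-id _

Any-⇔ : {P : A → Set b} {Q : A → Set c} →
        (∀ x → P x ⇔ Q x) → ∀ {xs} → Any P xs ⇔ Any Q xs
Any-⇔ P⇔Q = mk⇔ (Any.map (to (P⇔Q _))) (Any.map (from (P⇔Q _)))

Any-map-⇔ : {P : B → Set c} {f : A → B} {xs : List A} →
            Any P (List.map f xs) ⇔ Any (P ∘ f) xs
Any-map-⇔ = mk⇔ Any.map⁻ Any.map⁺

All-map-⇔ : {P : B → Set c} {f : A → B} {xs : List A} →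
            All P (List.map f xs) ⇔ All (P ∘ f) xs
All-map-⇔ = mk⇔ All.map⁻ All.map⁺

-- Moves a disjunction from a filtered list back to the whole list. The base and induction disjuncts
-- are filtered from the same clauses, so they can then be joined clause by clause.
Any-mapMaybe-⇔ : {P : B → Set c} (f : A → Maybe B) (xs : List A) →
                 Any P (List.mapMaybe f xs) ⇔ Any (MAny.Any P ∘ f) xs
Any-mapMaybe-⇔ {P = P} f xs = mk⇔ (mapMaybe⁻ xs) (Any.mapMaybe⁺ f xs ∘ Any.map⁺)
  where
  mapMaybe⁻ : ∀ xs → Any P (List.mapMaybe f xs) → Any (MAny.Any P ∘ f) xs
  mapMaybe⁻ (x ∷ xs) q with f x in eq
  ... | nothing = there (mapMaybe⁻ xs q)
  mapMaybe⁻ (x ∷ xs) (here q)  | just _ = here (≡.subst (MAny.Any P) (sym eq) (just q))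
  mapMaybe⁻ (x ∷ xs) (there q) | just _ = there (mapMaybe⁻ xs q)

Any-⊎-⇔ : {P : A → Set b} {Q : A → Set c} {xs : List A} →
          (Any P xs ⊎ Any Q xs) ⇔ Any (λ x → P x ⊎ Q x) xs
Any-⊎-⇔ = mk⇔ Any.Any-⊎⁺ Any.Any-⊎⁻

-- Comprehension for Boolean-valued relations.

module _ (em : ExcludedMiddle ℓ) where

  -- The set comprehension of `P`: excluded middle decides each value. Predicates arising from
  -- formulas, operators or intersections have to pass through it before they can interpret a
  -- predicate variable.
  ⟪_⟫ : {A : Set ℓ} → (A → Set ℓ) → 𝒫 A
  ⟪ P ⟫ x = ⌊ em {P x} ⌋

  ∈-⟪⟫ : {A : Set ℓ} (P : A → Set ℓ) {x : A} → x ∈ ⟪ P ⟫ ⇔ P x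
  ∈-⟪⟫ P = mk⇔ (toWitness ∘ lower) (Level.lift ∘ fromWitness)

-- Least fixed points of monotone operators.

module _ {M : Set ℓ} {ks : Fin n → ℕ} where

  Operator : Set _
  Operator = Relations M ks → ∀ i → Vec M (ks i) → Set ℓ

  infix 4 _⊑_
  _⊑_ : Relations M ks → Relations M ks → Set ℓ
  R ⊑ S = ∀ i xs → xs ∈ R i → xs ∈ S i

  IsPrefixedPoint : Operator → Relations M ks → Set ℓ
  IsPrefixedPoint F S = ∀ i xs → F S i xs → xs ∈ S i

  -- Both operators have the same fixed points. This is used where a substitution into the body of
  -- an `lfp` changes its operator only up to equivalence.
  IsLeastFixedPoint-cong : {F G : Operator} → (∀ S i xs → F S i xs ⇔ G S i xs) →
                           ∀ {R} → IsLeastFixedPoint F R → IsLeastFixedPoint G R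
  IsLeastFixedPoint-cong F⇔G (fixed , least) =
    (λ i xs → ⇔-trans (⇔-sym (F⇔G _ i xs)) (fixed i xs)) ,
    (λ S fixedS → least S λ i xs → ⇔-trans (F⇔G _ i xs) (fixedS i xs))

  module KnasterTarski
    (em : ExcludedMiddle ℓ) (F : Operator)
    (mono : ∀ {R S} → R ⊑ S → ∀ i xs → F R i xs → F S i xs) where

    -- Because relations are Boolean-valued, this impredicative quantification over `S` remains in
    -- `Set ℓ`, where `em` can decide it.
    InEveryPrefixedPoint : ∀ i → Vec M (ks i) → Set ℓ
    InEveryPrefixedPoint i xs = ∀ S → IsPrefixedPoint F S → xs ∈ S i

    ⨅ : Relations M ks
    ⨅ i = ⟪_⟫ em (InEveryPrefixedPoint i)

    ⨅-lower : ∀ {S} → IsPrefixedPoint F S → ⨅ ⊑ S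
    ⨅-lower {S} pre i xs x∈ = to (∈-⟪⟫ em (InEveryPrefixedPoint i)) x∈ S pre

    ⨅-prefixed : IsPrefixedPoint F ⨅
    ⨅-prefixed i xs x∈ =
      from (∈-⟪⟫ em (InEveryPrefixedPoint i)) λ S pre → pre i xs (mono (⨅-lower pre) i xs x∈)

    ⨅-fixed : IsFixedPoint F ⨅
    ⨅-fixed i xs = mk⇔ (⨅-prefixed i xs)
      (to (∈-⟪⟫ em (F ⨅ i)) ∘ ⨅-lower F⨅-prefixed i xs)
      where
      -- `F ⨅`, represented as a relation, lies below `⨅`; applying `F` to this inclusion makes it
      -- prefixed, so `⨅` in turn lies below it.
      F⨅-prefixed : IsPrefixedPoint F (λ j → ⟪_⟫ em (F ⨅ j))
      F⨅-prefixed j ys y∈ = from (∈-⟪⟫ em (F ⨅ j))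
        (mono (λ j ys → ⨅-prefixed j ys ∘ to (∈-⟪⟫ em (F ⨅ j))) j ys y∈)

    ⨅-isLeastFixedPoint : IsLeastFixedPoint F ⨅
    ⨅-isLeastFixedPoint =
      ⨅-fixed , λ S fixed → ⨅-lower λ i xs → to (fixed i xs)

    -- The left side is the shape of `Sat` at an `lfp`. Any least fixed point `R` lies below the
    -- fixed point `⨅`, so the existential can be traded for this one witness.
    ∈-lfp : ∀ {i xs} →
            (Σ[ R ∈ Relations M ks ] IsLeastFixedPoint F R × xs ∈ R i) ⇔ xs ∈ ⨅ i
    ∈-lfp = mk⇔ (λ (R , (_ , least) , x∈) → least ⨅ ⨅-fixed _ _ x∈)
                (λ x∈ → ⨅ , ⨅-isLeastFixedPoint , x∈)

-- Substitution lemmas.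

module _ {𝓛 : Language a} (M : Structure 𝓛 ℓ) where

  open Structure M using (Domain; funI)

  eval-lookup : (ρ : Vec Domain p) (σ : Vec (Term 𝓛 p) n) (x : Fin n) →
                eval M ρ (Vec.lookup σ x) ≡ Vec.lookup (evals M ρ σ) x
  eval-lookup ρ (t ∷ σ) Fin.zero    = refl
  eval-lookup ρ (t ∷ σ) (Fin.suc x) = eval-lookup ρ σ x

  eval-substTerm   : (ρ : Vec Domain p) (σ : Vec (Term 𝓛 p) n) (t : Term 𝓛 n) →
                     eval M ρ (substTerm σ t) ≡ eval M (evals M ρ σ) t
  evals-substTerms : (ρ : Vec Domain p) (σ : Vec (Term 𝓛 p) n) (ts : Vec (Term 𝓛 n) k) →
                     evals M ρ (substTerms σ ts) ≡ evals M (evals M ρ σ) ts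

  eval-substTerm ρ σ (var x)    = eval-lookup ρ σ x
  eval-substTerm ρ σ (fun f ts) = cong (funI f) (evals-substTerms ρ σ ts)

  evals-substTerms ρ σ []       = refl
  evals-substTerms ρ σ (t ∷ ts) = cong₂ _∷_ (eval-substTerm ρ σ t) (evals-substTerms ρ σ ts)

  evals-++ : (ρ : Vec Domain n) (ts : Vec (Term 𝓛 n) k) (us : Vec (Term 𝓛 n) m) →
             evals M ρ (ts ++ us) ≡ evals M ρ ts ++ evals M ρ us
  evals-++ ρ []       us = refl
  evals-++ ρ (t ∷ ts) us = cong (_ ∷_) (evals-++ ρ ts us)

  evals-tabulate-var : (ρ : Vec Domain n) (f : Fin k → Fin n) →
    evals M ρ (Vec.tabulate (var ∘ f)) ≡ Vec.tabulate (Vec.lookup ρ ∘ f)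
  evals-tabulate-var {k = zero}  ρ f = refl
  evals-tabulate-var {k = suc k} ρ f = cong (_ ∷_) (evals-tabulate-var ρ (f ∘ Fin.suc))

  evals-vars : (ρ : Vec Domain n) → evals M ρ (vars n) ≡ ρ
  evals-vars ρ = trans (evals-tabulate-var ρ _) (tabulate∘lookup ρ)

  evals-varsˡ : (xs : Vec Domain k) (ρ : Vec Domain n) →
                evals M (xs ++ ρ) (varsˡ k n) ≡ xs
  evals-varsˡ xs ρ = trans (evals-tabulate-var (xs ++ ρ) _)
    (trans (tabulate-cong (lookup-++ˡ xs ρ)) (tabulate∘lookup xs))

  evals-varsʳ : (xs : Vec Domain k) (ρ : Vec Domain n) →
                evals M (xs ++ ρ) (varsʳ k n) ≡ ρ
  evals-varsʳ xs ρ = trans (evals-tabulate-var (xs ++ ρ) _)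
    (trans (tabulate-cong (lookup-++ʳ xs ρ)) (tabulate∘lookup ρ))

  evals-lift : (xs : Vec Domain k) (ρ : Vec Domain p) (σ : Vec (Term 𝓛 p) n) →
               evals M (xs ++ ρ) (lift k σ) ≡ xs ++ evals M ρ σ
  evals-lift {k} {p} xs ρ σ = trans
    (evals-++ (xs ++ ρ) (varsˡ k p) _)
    (cong₂ _++_ (evals-varsˡ xs ρ)
      (trans (evals-substTerms (xs ++ ρ) (varsʳ k p) σ)
             (cong (λ ρ → evals M ρ σ) (evals-varsʳ xs ρ))))

  Sat-subst : {I : Relations Domain ar} {ρ : Vec Domain p}
              (σ : Vec (Term 𝓛 p) n) (φ : Formula 𝓛 ar n l) →
              Sat M I ρ (subst σ φ) ⇔ Sat M I (evals M ρ σ) φ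
  -- The block length `k` is arbitrary because a first-order quantifier binds one variable, while a
  -- component of an `lfp` binds a whole argument tuple.
  Sat-subst-lift : {I : Relations Domain ar} {ρ : Vec Domain p}
                   (σ : Vec (Term 𝓛 p) n) (φ : Formula 𝓛 ar (k + n) l) (xs : Vec Domain k) →
                   Sat M I (xs ++ ρ) (subst (lift k σ) φ) ⇔
                   Sat M I (xs ++ evals M ρ σ) φ

  Sat-subst σ ⊥̇           = ⇔-id _
  Sat-subst {ρ = ρ} σ (t ≐ u) =
    mk⇔ (λ e → trans (sym (eval-substTerm ρ σ t)) (trans e (eval-substTerm ρ σ u)))
        (λ e → trans (eval-substTerm ρ σ t) (trans e (sym (eval-substTerm ρ σ u))))
  Sat-subst {ρ = ρ} σ (rel P ts) =
    ≡⇒⇔ (_∈ Structure.predI M P) (evals-substTerms ρ σ ts)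
  Sat-subst {I = I} {ρ} σ (pvar X ts) = ≡⇒⇔ (_∈ I X) (evals-substTerms ρ σ ts)
  Sat-subst σ (φ ∧̇ ψ)     = Sat-subst σ φ ×-⇔ Sat-subst σ ψ
  Sat-subst σ (φ ∨̇ ψ)     = Sat-subst σ φ ⊎-⇔ Sat-subst σ ψ
  Sat-subst σ (φ ⇒̇ ψ)     = →-cong-⇔ (Sat-subst σ φ) (Sat-subst σ ψ)
  Sat-subst σ (∀̇ φ)       = ∀-⇔ λ x → Sat-subst-lift σ φ (x ∷ [])
  Sat-subst σ (∃̇ φ)       = ∃-⇔ λ x → Sat-subst-lift σ φ (x ∷ [])
  Sat-subst σ (∀² ks φ)   = ∀-⇔ λ R → Sat-subst σ φ
  Sat-subst σ (∃² ks φ)   = ∃-⇔ λ R → Sat-subst σ φ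
  -- The induction hypothesis makes the two operators agree pointwise, so the same `R` is a least
  -- fixed point of both.
  Sat-subst {ρ = ρ} σ (lfp ks Φ _ i ts) = ∃-⇔ λ R →
    mk⇔ (IsLeastFixedPoint-cong λ S j → Sat-subst-lift σ (Φ j))
        (IsLeastFixedPoint-cong λ S j xs → ⇔-sym (Sat-subst-lift σ (Φ j) xs))
    ×-⇔ ≡⇒⇔ (_∈ R i) (evals-substTerms ρ σ ts)

  Sat-subst-lift {I = I} {ρ} σ φ xs = ⇔-trans (Sat-subst (lift _ σ) φ)
    (≡⇒⇔ (λ ρ → Sat M I ρ φ) (evals-lift xs ρ σ))

  -- At an atom this reduces to `Sat-subst`. Since `χ X` has only its arguments free, the relation
  -- it defines is independent of `ρ`, and the hypothesis passes unchanged under quantifiers.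
  Sat-[] : {I : Relations Domain ar′} {J : Relations Domain ar}
           {χ : ∀ X → Formula 𝓛 ar′ (ar X) l} →
           (∀ X xs → xs ∈ J X ⇔ Sat M I xs (χ X)) →
           ∀ {ρ : Vec Domain n} (φ : Formula 𝓛 ar n FO) →
           Sat M I ρ (φ [ χ ]) ⇔ Sat M J ρ φ
  Sat-[] J⇔χ ⊥̇          = ⇔-id _
  Sat-[] J⇔χ (t ≐ u)    = ⇔-id _
  Sat-[] J⇔χ (rel P ts) = ⇔-id _
  Sat-[] {χ = χ} J⇔χ (pvar X ts) =
    ⇔-trans (Sat-subst ts (χ X)) (⇔-sym (J⇔χ X _))
  Sat-[] J⇔χ (φ ∧̇ ψ)    = Sat-[] J⇔χ φ ×-⇔ Sat-[] J⇔χ ψ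
  Sat-[] J⇔χ (φ ∨̇ ψ)    = Sat-[] J⇔χ φ ⊎-⇔ Sat-[] J⇔χ ψ
  Sat-[] J⇔χ (φ ⇒̇ ψ)    = →-cong-⇔ (Sat-[] J⇔χ φ) (Sat-[] J⇔χ ψ)
  Sat-[] J⇔χ (∀̇ φ)      = ∀-⇔ λ x → Sat-[] J⇔χ φ
  Sat-[] J⇔χ (∃̇ φ)      = ∃-⇔ λ x → Sat-[] J⇔χ φ

  Sat-embed : {I : Relations Domain ar} (J : Relations Domain ∅) {ρ : Vec Domain n}
              (φ : Formula 𝓛 ∅ n FO) →
              Sat M I ρ (embed {l = l} φ) ⇔ Sat M J ρ φ
  Sat-embed J φ = Sat-[] (λ ()) φ

  -- Finite connectives, quantifier blocks and equality of tuples.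

  module _ {ar : V → ℕ} {I : Relations Domain ar} where

    Sat-⋀ : {ρ : Vec Domain n} (φs : List (Formula 𝓛 ar n l)) →
            Sat M I ρ (⋀ φs) ⇔ All (Sat M I ρ) φs
    Sat-⋀ []       = mk⇔ (λ _ → []) (λ _ ())
    Sat-⋀ (φ ∷ φs) = mk⇔ (λ (s , ss) → s ∷ to (Sat-⋀ φs) ss)
                         (λ { (s ∷ ss) → s , from (Sat-⋀ φs) ss })

    Sat-⋁ : {ρ : Vec Domain n} (φs : List (Formula 𝓛 ar n l)) →
            Sat M I ρ (⋁ φs) ⇔ Any (Sat M I ρ) φs
    Sat-⋁ []       = mk⇔ (λ ()) (λ ())
    Sat-⋁ (φ ∷ φs) = mk⇔ [ here , there ∘ to (Sat-⋁ φs) ]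
      (λ { (here s) → inj₁ s ; (there ss) → inj₂ (from (Sat-⋁ φs) ss) })

    Sat-∀* : ∀ v {φ : Formula 𝓛 ar v l} →
             Sat M I [] (∀* v φ) ⇔ (∀ ρ → Sat M I ρ φ)
    Sat-∀* zero    = mk⇔ (λ { s [] → s }) (λ f → f [])
    Sat-∀* (suc v) = ⇔-trans (Sat-∀* v)
      (mk⇔ (λ { f (x ∷ ρ) → f ρ x }) (λ f ρ x → f (x ∷ ρ)))

    Sat-∃* : ∀ v {ρ : Vec Domain n} {φ : Formula 𝓛 ar (v + n) l} →
             Sat M I ρ (∃* v φ) ⇔ (∃[ ys ] Sat M I (ys ++ ρ) φ)
    Sat-∃* zero    = mk⇔ (λ s → [] , s) (λ { ([] , s) → s })
    Sat-∃* (suc v) = ⇔-trans (Sat-∃* v)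
      (mk⇔ (λ (ys , x , s) → x ∷ ys , s) (λ { (x ∷ ys , s) → ys , x , s }))

    Sat-≐* : {ρ : Vec Domain n} (ts us : Vec (Term 𝓛 n) k) →
             Sat M I ρ (_≐*_ {l = l} ts us) ⇔ evals M ρ ts ≡ evals M ρ us
    Sat-≐* []       []       = mk⇔ (λ _ → refl) (λ _ ())
    Sat-≐* (t ∷ ts) (u ∷ us) = mk⇔
      (λ (e , es) → cong₂ _∷_ e (to (Sat-≐* ts us) es))
      (λ eq → Product.map₂ (from (Sat-≐* ts us)) (∷-injective eq))

  -- Constraints contain no predicate variables; I merely interprets the empty
  -- context.
  module _ {n : ℕ} {ks : Fin n → ℕ} (I : Relations Domain ∅) where

    -- Horn clauses as closure rules on relations.

    HoldsAtom : Relations Domain ks → Vec Domain k → Atom 𝓛 ks k → Set ℓ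
    HoldsAtom S ρ (i , ts) = evals M ρ ts ∈ S i

    HoldsHead : Relations Domain ks → Vec Domain k → Maybe (Atom 𝓛 ks k) → Set ℓ
    HoldsHead S ρ nothing  = Poly.⊥
    HoldsHead S ρ (just A) = HoldsAtom S ρ A

    HoldsAntecedent : Relations Domain ks → Vec Domain k → Clause 𝓛 ks k → Set (a ⊔ ℓ)
    HoldsAntecedent S ρ (clause φ body _) = Sat M I ρ φ × All (HoldsAtom S ρ) body

    HoldsClause : Relations Domain ks → Vec Domain k → Clause 𝓛 ks k → Set (a ⊔ ℓ)
    HoldsClause S ρ C = HoldsAntecedent S ρ C → HoldsHead S ρ (Clause.head C)

    -- One step of the immediate consequence operator of logic programming: under `ρ`, the clause
    -- derives `xs` for the `j`-th predicate. Base and induction clauses are treated alike.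
    Fires : Relations Domain ks → Vec Domain k → ∀ j → Vec Domain (ks j) →
            Clause 𝓛 ks k → Set (a ⊔ ℓ)
    Fires S ρ j xs C =
      ∃[ s ] Clause.head C ≡ just (j , s) × HoldsAntecedent S ρ C × xs ≡ evals M ρ s

    HoldsAntecedent-mono : ∀ {R S} → R ⊑ S → {ρ : Vec Domain k} (C : Clause 𝓛 ks k) →
                           HoldsAntecedent R ρ C → HoldsAntecedent S ρ C
    HoldsAntecedent-mono R⊑S C (sφ , sbody) = sφ , All.map (R⊑S _ _) sbody

    Fires-mono : ∀ {R S} → R ⊑ S → ∀ {ρ : Vec Domain k} {j xs} {C : Clause 𝓛 ks k} →
                 Fires R ρ j xs C → Fires S ρ j xs C
    Fires-mono R⊑S {C = C} (s , hd , ante , eq) =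
      s , hd , HoldsAntecedent-mono R⊑S C ante , eq

    fire : ∀ {S} {ρ : Vec Domain k} {j xs} {C : Clause 𝓛 ks k} →
           HoldsClause S ρ C → Fires S ρ j xs C → xs ∈ S j
    fire holds (_ , refl , ante , refl) = holds ante

    module _ {S : Relations Domain ks} where

      -- The conjunction is nested to the left, so the accumulated conjunct `φ` has to vary in the
      -- induction.
      Sat-foldl : {ρ : Vec Domain k} (φ : Formula 𝓛 (∅ ▹ ks) k l) (As : List (Atom 𝓛 ks k)) →
                  Sat M [ S , I ] ρ (List.foldl _∧̇_ φ (List.map atom As)) ⇔
                  (Sat M [ S , I ] ρ φ × All (HoldsAtom S ρ) As)
      Sat-foldl φ []       = mk⇔ (λ s → s , []) proj₁
      Sat-foldl φ (A ∷ As) = ⇔-trans (Sat-foldl (φ ∧̇ atom A) As)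
        (mk⇔ (λ ((s , sA) , sAs) → s , sA ∷ sAs)
             (λ { (s , sA ∷ sAs) → (s , sA) , sAs }))

      Sat-clause : {ρ : Vec Domain k} (C : Clause 𝓛 ks k) →
                   Sat M [ S , I ] ρ (clauseFormula {l = l} C) ⇔ HoldsClause S ρ C
      Sat-clause {ρ = ρ} (clause φ body hd) = →-cong-⇔
        (⇔-trans (Sat-foldl (embed φ) body) (Sat-embed I φ ×-⇔ ⇔-id _))
        (Sat-head hd)
        where
        Sat-head : ∀ hd → Sat M [ S , I ] ρ (headFormula hd) ⇔ HoldsHead S ρ hd
        Sat-head nothing  = ⇔-id _
        Sat-head (just A) = ⇔-id _

      Sat-clauses : (ψ : HornClauses 𝓛 ks) →
                    Sat M [ S , I ] [] (⟦_⟧ {l = l} ψ) ⇔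
                    (∀ ρ → All (HoldsClause S ρ) (HornClauses.clauses ψ))
      Sat-clauses (hornClauses {v} Cs) = ⇔-trans (Sat-∀* v) (∀-⇔ λ ρ →
        ⇔-trans (Sat-⋀ _) (⇔-trans All-map-⇔
          (mk⇔ (All.map (to (Sat-clause _))) (All.map (from (Sat-clause _))))))

      -- The disjuncts of `Φ[ ψ ]` as rule applications.

      module _ (l : Logic) {v : ℕ} {j : Fin n} (ρ : Vec Domain v) (xs : Vec Domain (ks j)) where

        private
          ȳ : Vec (Term 𝓛 (v + ks j)) v
          ȳ = varsˡ v (ks j)
          x̄ : Vec (Term 𝓛 (v + ks j)) (ks j)
          x̄ = varsʳ v (ks j)

        Sat-constraint : (φ : Formula 𝓛 ∅ v FO) →
          Sat M [ S , I ] (ρ ++ xs) (embed {ar = ∅ ▹ ks} {l = l} (subst ȳ φ)) ⇔ Sat M I ρ φ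
        Sat-constraint φ = ⇔-trans (Sat-embed I (subst ȳ φ)) (⇔-trans (Sat-subst ȳ φ)
          (≡⇒⇔ (λ ρ → Sat M I ρ φ) (evals-varsˡ ρ xs)))

        evals-ȳ : (ts : Vec (Term 𝓛 v) k) →
                  evals M (ρ ++ xs) (substTerms ȳ ts) ≡ evals M ρ ts
        evals-ȳ ts = trans (evals-substTerms (ρ ++ xs) ȳ ts)
          (cong (λ ρ → evals M ρ ts) (evals-varsˡ ρ xs))

        Sat-args : (s : Vec (Term 𝓛 v) (ks j)) →
          Sat M [ S , I ] (ρ ++ xs) (_≐*_ {ar = ∅ ▹ ks} {l = l} x̄ (substTerms ȳ s)) ⇔ xs ≡ evals M ρ s
        Sat-args s = ⇔-trans (Sat-≐* {ar = ∅ ▹ ks} {l = l} x̄ (substTerms ȳ s))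
          (mk⇔ (λ eq → trans (sym (evals-varsʳ ρ xs)) (trans eq (evals-ȳ s)))
               (λ eq → trans (evals-varsʳ ρ xs) (trans eq (sym (evals-ȳ s)))))

        Sat-body : (As : List (Atom 𝓛 ks v)) →
          Sat M [ S , I ] (ρ ++ xs) (⋀ (List.map (subst ȳ ∘ atom {l = l}) As)) ⇔
          All (HoldsAtom S ρ) As
        Sat-body As = ⇔-trans (Sat-⋀ (List.map (subst ȳ ∘ atom {l = l}) As)) (⇔-trans All-map-⇔
          (mk⇔ (All.map (λ {B} → to (≡⇒⇔ (_∈ S (proj₁ B)) (evals-ȳ (proj₂ B)))))
               (All.map (λ {B} → from (≡⇒⇔ (_∈ S (proj₁ B)) (evals-ȳ (proj₂ B)))))))

        -- What a single clause contributes to the body of `Φ[ ψ ] j`; `MAny.Any` is false when the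
        -- clause is not of the respective kind.
        Disjunct : Clause 𝓛 ks v → Set (a ⊔ ℓ)
        Disjunct C =
          MAny.Any (Sat M [ S , I ] (ρ ++ xs) ∘ baseDisjunct {l = l}) (asBase j C) ⊎
          MAny.Any (Sat M [ S , I ] (ρ ++ xs) ∘ inductionDisjunct {l = l}) (asInduction j C)

        -- An empty body selects the base disjunct and a nonempty one the induction disjunct. A
        -- clause whose head is `nothing` or another predicate gives no disjunct and cannot fire for
        -- `j`.
        Disjunct-⇔ : ∀ C → Disjunct C ⇔ Fires S ρ j xs C
        Disjunct-⇔ (clause φ []       nothing) = mk⇔ (λ { (inj₁ ()) ; (inj₂ ()) }) (λ ())
        Disjunct-⇔ (clause φ (_ ∷ _)  nothing) = mk⇔ (λ { (inj₁ ()) ; (inj₂ ()) }) (λ ())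
        Disjunct-⇔ (clause φ [] (just (i , s))) with i ≟ j
        ... | yes refl = mk⇔
          (λ { (inj₁ (just (sφ , eq))) →
               s , refl , (to (Sat-constraint φ) sφ , []) , to (Sat-args s) eq })
          (λ { (_ , refl , (sφ , []) , eq) →
               inj₁ (just (from (Sat-constraint φ) sφ , from (Sat-args s) eq)) })
        ... | no i≢j = mk⇔ (λ { (inj₁ ()) ; (inj₂ ()) })
                           (λ { (_ , refl , _) → contradiction refl i≢j })
        Disjunct-⇔ (clause φ (A ∷ As) (just (i , s))) with i ≟ j
        ... | yes refl = mk⇔
          (λ { (inj₂ (just (sφ , sAs , eq))) →
               s , refl , (to (Sat-constraint φ) sφ , to (Sat-body (A ∷ As)) sAs)
               , to (Sat-args s) eq })
          (λ { (_ , refl , (sφ , sAs) , eq) →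
               inj₂ (just (from (Sat-constraint φ) sφ , from (Sat-body (A ∷ As)) sAs
                          , from (Sat-args s) eq)) })
        ... | no i≢j = mk⇔ (λ { (inj₁ ()) ; (inj₂ ()) })
                           (λ { (_ , refl , _) → contradiction refl i≢j })

      Sat-Φ : (ψ : HornClauses 𝓛 ks) → ∀ {j xs} →
              Sat M [ S , I ] xs (Φ[_] {l = l} ψ j) ⇔
              (∃[ ρ ] Any (Fires S ρ j xs) (HornClauses.clauses ψ))
      Sat-Φ (hornClauses {v} Cs) {j} {xs} = ⇔-trans (Sat-∃* v) (∃-⇔ λ ρ →
        ⇔-trans (disjunction (asBase j) ⊎-⇔ disjunction (asInduction j))
          (⇔-trans Any-⊎-⇔ (Any-⇔ (Disjunct-⇔ _ ρ xs))))
        where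
        disjunction : {ρ : Vec Domain (v + ks j)} {C : Set a} {f : C → Formula 𝓛 (∅ ▹ ks) _ l}
          (g : Clause 𝓛 ks v → Maybe C) →
          Sat M [ S , I ] ρ (⋁ (List.map f (List.mapMaybe g Cs))) ⇔
          Any (MAny.Any (Sat M [ S , I ] ρ ∘ f) ∘ g) Cs
        disjunction g =
          ⇔-trans (Sat-⋁ _) (⇔-trans Any-map-⇔ (Any-mapMaybe-⇔ g Cs))

    -- The least fixed point as least solution.

    module _ (em : ExcludedMiddle ℓ) (ψ : HornClauses 𝓛 ks) where

      HoldsClauses : Relations Domain ks → Set (a ⊔ ℓ)
      HoldsClauses S = ∀ ρ → All (HoldsClause S ρ) (HornClauses.clauses ψ)

      ΦOperator : Operator
      ΦOperator S j xs = Sat M [ S , I ] xs (Φ[_] {l = FO[LFP]} ψ j)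

      -- Read off from the rules rather than from the syntactic positivity of `Φ[ ψ ]`: `S` enters a
      -- firing only through the atoms of the body.
      ΦOperator-mono : ∀ {R S} → R ⊑ S → ∀ i xs → ΦOperator R i xs → ΦOperator S i xs
      ΦOperator-mono R⊑S i xs =
        from (Sat-Φ ψ) ∘ Product.map₂ (Any.map (Fires-mono R⊑S)) ∘ to (Sat-Φ ψ)

      open KnasterTarski em ΦOperator ΦOperator-mono

      -- The arguments `xs` of `μ ψ j` are parameters in the weakened body of the fixed point.
      -- Evaluating the weakening discards them, so the same `⨅` serves for every `xs`.
      Sat-μ : ∀ {j xs} → Sat M I xs (μ ψ j) ⇔ xs ∈ ⨅ j
      Sat-μ {j} {xs} = ⇔-trans
        (∃-⇔ λ R →
          mk⇔ (IsLeastFixedPoint-cong weakening)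
              (IsLeastFixedPoint-cong λ S i ys → ⇔-sym (weakening S i ys))
          ×-⇔ ≡⇒⇔ (_∈ R j) (evals-vars xs))
        ∈-lfp
        where
        weakening : ∀ S i ys →
          Sat M [ S , I ] (ys ++ xs) (subst (varsˡ (ks i) (ks j)) (Φ[ ψ ] i)) ⇔
          ΦOperator S i ys
        weakening S i ys = ⇔-trans (Sat-subst (varsˡ (ks i) (ks j)) (Φ[ ψ ] i))
          (≡⇒⇔ (λ ρ → Sat M [ S , I ] ρ (Φ[ ψ ] i)) (evals-varsˡ ys xs))

      -- A tuple produced by the operator comes from some firing clause; that clause is true in `S`,
      -- which places the tuple in `S`.
      holdsClauses⇒prefixed : ∀ {S} → HoldsClauses S → IsPrefixedPoint ΦOperator S
      holdsClauses⇒prefixed {S} holds i xs s =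
        let ρ , fires = to (Sat-Φ ψ) s in
        All.lookupWith fire (holds ρ) fires

      ⨅-holdsClauses : ∀ {S} → HoldsClauses S → HoldsClauses ⨅
      ⨅-holdsClauses {S} holds ρ = All.tabulate (holdsClause _)
        where
        holdsClause : ∀ C → C ∈ˡ HornClauses.clauses ψ → HoldsClause ⨅ ρ C
        -- The clause itself fires on its head instance, and `⨅` is closed under firing.
        holdsClause (clause _ _ (just (i , s))) C∈ ante =
          ⨅-prefixed i _ (from (Sat-Φ ψ) (ρ , lose C∈ (s , refl , ante , refl)))
        -- Only here is the given solution `S` needed: the antecedent moves up from `⨅` to `S`,
        -- where the clause refutes it.
        holdsClause C@(clause _ _ nothing) C∈ ante =
          All.lookup (holds ρ) C∈
            (HoldsAntecedent-mono (⨅-lower (holdsClauses⇒prefixed holds)) C ante)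

      Sat-⟨⟩ : {χ : ∀ j → Formula 𝓛 ∅ (ks j) l} {S : Relations Domain ks} →
               (∀ j xs → xs ∈ S j ⇔ Sat M I xs (χ j)) →
               Sat M I [] (ψ ⟨ χ ⟩) ⇔ HoldsClauses S
      Sat-⟨⟩ S⇔χ = ⇔-trans
        (Sat-[] (λ { (inj₁ j) → S⇔χ j ; (inj₂ ()) }) ⟦ ψ ⟧)
        (Sat-clauses ψ)

      -- The second-order witness `S` need not be definable; it serves only to show that the
      -- definable tuple `μ ψ` violates no clause.
      μ-solution : Sat M I [] (hornEquation ψ) → Sat M I [] (ψ ⟨ μ ψ ⟩)
      μ-solution (S , s) = from (Sat-⟨⟩ λ _ _ → ⇔-sym Sat-μ)
        (⨅-holdsClauses (to (Sat-clauses ψ) s))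

      μ-least : (χ : ∀ j → Formula 𝓛 ∅ (ks j) l) → Sat M I [] (ψ ⟨ χ ⟩) →
                ∀ j xs → Sat M I xs (μ ψ j) → Sat M I xs (χ j)
      -- The relations defined by `χ` are formed by comprehension; as a solution they are a prefixed
      -- point, hence above `⨅`.
      μ-least χ s j xs x∈μ = to (∈-⟪⟫ em λ xs → Sat M I xs (χ j))
        (⨅-lower (holdsClauses⇒prefixed holds) j xs (to Sat-μ x∈μ))
        where
        holds = to (Sat-⟨⟩ λ j _ → ∈-⟪⟫ em λ xs → Sat M I xs (χ j)) s

theorem7 : ∀ {a ℓ} → ExcludedMiddle ℓ →
    (𝓛 : Language a) {n : ℕ} (ks : Fin n → ℕ) (ψ : HornClauses 𝓛 ks) →
    Valid ℓ (hornEquation ψ) →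
    Valid ℓ (ψ ⟨ μ ψ ⟩)
    × ((χ : ∀ j → Formula 𝓛 ∅ (ks j) FO[LFP]) →
    Valid ℓ (ψ ⟨ χ ⟩) →
    Valid ℓ (⋀ (tabulate λ j → ∀* (ks j) (μ ψ j ⇒̇ χ j))))
theorem7 em 𝓛 ks ψ valid =
  (λ M → μ-solution M _ em ψ (valid M)) ,
  (λ χ validχ M → from (Sat-⋀ M _) (All.tabulate⁺ λ j →
    from (Sat-∀* M (ks j)) (μ-least M _ em ψ χ (validχ M) j)))
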